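{- Let $m\geq n>0$ and $p,q\geq 0$ be integers. Let $\{s_i\}_{i\geq 1}$ be the sequence consisting of $p$ ones, followed by $\binom{m}{0},\binom{m}{1},\ldots,\binom{m}{m}$, followed by zeros, and let $\{t_i\}_{i\geq 1}$ be the sequence consisting of $q$ ones, followed by $\binom{n}{0},\binom{n}{1},\ldots,\binom{n}{n}$, followed by zeros. Let $\{r_i\}_{i\geq 1}$ be their convolution, $r_i=\sum_{j=1}^{i}s_j\,t_{i-j+1}$ for $i\geq 1$. Then the sequence $\{r_i\}_{i\geq 1}$ is unimodal if and only if at least one of the following conditions holds: (i) $m>q$; (ii) $n>p$; (iii) $m=n=2$; (iv) $n=1$.
   Context: A sequence $(a_i)_{i\ge 1}$ of real numbers is unimodal if there is an index $k$ such that $a_1\leq a_2\leq\cdots\leq a_k\geq a_{k+1}\geq a_{k+2}\geq\cdots$. Explicitly, $s_i=1$ for $1\le i\le p$, $s_{p+1+l}=\binom{m}{l}$ for $0\le l\le m$, and $s_i=0$ for $i>p+m+1$; similarly for $t_i$ with $q,n$ in place of $p,m$. -}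

module Defs where

open import Data.List.Base using (map; upTo)
open import Data.Nat.Base using (ℕ; zero; suc; _*_; _∸_; _≤_; _<_)
open import Data.Nat.Combinatorics using (_C_)
open import Data.Nat.ListAction using (sum)
open import Data.Product.Base using (∃-syntax; _×_)

-- A sequence (aᵢ)_{i ≥ 1} is stored with its index lowered by one: the
-- value at i : ℕ is the term a_{i+1}.  All the sequences considered here
-- consist of natural numbers.
Sequence : Set
Sequence = ℕ → ℕ

-- The peak may be the first term, so nonincreasing sequences are unimodal.
Unimodal : Sequence → Set
Unimodal a = ∃[ k ] (∀ i → i < k → a i ≤ a (suc i))
                  × (∀ i → k ≤ i → a (suc i) ≤ a i)

-- The trailing zeros come from m C l being 0 for l > m.
onesThenBinomials : (p m : ℕ) → Sequence
onesThenBinomials zero    m i       = m C i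
onesThenBinomials (suc p) m zero    = 1
onesThenBinomials (suc p) m (suc i) = onesThenBinomials p m i

-- With the lowered indices, rᵢ = Σ_{j=1}^{i} sⱼ t_{i-j+1} becomes
-- r i = Σ_{j=0}^{i} s j * t (i - j).
convolution : Sequence → Sequence → Sequence
convolution s t i = sum (map (λ j → s j * t (i ∸ j)) (upTo (suc i)))

{-# OPTIONS --safe #-}

-- Write N = m + n and d(k) = r(i + 1) − r(i) at i = p + q + k − 1 (lowered
-- indices).  For k ≥ 1,
--   d(k) = C(N,k) − C(N,k−1) − C(m,k) − C(n,k) + C(m,k+q) + C(n,k+p).
-- If m ≤ q and n ≤ p, then d(1) = −1 and d(2) = (m−1)(n−1) − 1, so r falls
-- and then rises as soon as (m−1)(n−1) > 1.
-- For the converse, let e(k) be d(k) without its last two terms.  Then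
--   k ((k+1) e(k+1) − (m−k) e(k))
--     = C(N,k−1) ((n−1)(N+1) − 2nk) + k (m−n) C(n,k),
-- so e(k)/C(m,k) increases while 2nk ≤ (n−1)(N+1) and, since the last summand
-- is then negligible, decreases afterwards.  The two shifted terms shrink at
-- least as fast as C(m,k), so past that threshold d stays ≤ 0 once it is ≤ 0.
module Submission where

open import Defs
open import Data.Empty using (⊥-elim)
open import Data.List.Properties using (map-applyUpTo; map-upTo)
open import Data.Nat.Base
open import Data.Nat.Combinatorics using (_C_; nC1≡n; nCn≡1; k>n⇒nCk≡0; nCk+nC[k+1]≡[n+1]C[k+1])
open import Data.Nat.DivMod using (m/n*n≤m; m*n/n≡m; /-monoˡ-≤)
open import Data.Nat.ListAction using (sum)
open import Data.Nat.Properties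
open import Data.Nat.Tactic.RingSolver using (solve-∀)
open import Data.Product.Base using (∃-syntax; _×_; _,_)
import Data.Sum.Base as Sum
open import Data.Sum.Base using (_⊎_; inj₁; inj₂)
open import Function.Base using (_∘_)
open import Function.Bundles using (_⇔_; mk⇔)
open import Relation.Binary.PropositionalEquality
open import Relation.Nullary using (¬_)

-- Binomial coefficients

pascal : ∀ n k → suc n C suc k ≡ n C k + n C suc k
pascal n k = sym (nCk+nC[k+1]≡[n+1]C[k+1] n k)

k≤n⇒1≤nCk : ∀ {n k} → k ≤ n → 1 ≤ n C k
k≤n⇒1≤nCk {n}     {zero}  _         = ≤-refl
k≤n⇒1≤nCk {suc n} {suc k} (s≤s k≤n) =
  subst (1 ≤_) (sym (pascal n k)) (≤-trans (k≤n⇒1≤nCk k≤n) (m≤m+n _ _))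

n≤nCk : ∀ {n k} → 1 ≤ k → k < n → n ≤ n C k
n≤nCk {n}     {suc zero}      _ _           = ≤-reflexive (sym (nC1≡n n))
n≤nCk {suc n} {suc k@(suc _)} _ (s≤s 1+k≤n) = begin
  suc n                ≡⟨ +-comm 1 n ⟩
  n + 1                ≤⟨ +-mono-≤ (n≤nCk (s≤s z≤n) 1+k≤n) (k≤n⇒1≤nCk 1+k≤n) ⟩
  n C k + n C suc k    ≡⟨ pascal n k ⟨
  suc n C suc k        ∎
  where open ≤-Reasoning

-- This is (k+1) C(n,k+1) = (n-k) C(n,k) with the subtraction moved to the left, so that it also
-- covers k > n. All later ratio estimates rest on it.
absorption : ∀ n k → suc k * (n C suc k) + k * (n C k) ≡ n * (n C k)
absorption zero    zero    = refl
absorption zero    (suc k) = cong₂ _+_ (*-zeroʳ (suc (suc k))) (*-zeroʳ (suc k))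
absorption (suc n) zero    = begin
  1 * (suc n C 1) + 0  ≡⟨ cong (λ z → 1 * z + 0) (nC1≡n (suc n)) ⟩
  1 * suc n + 0        ≡⟨ lemma (suc n) ⟩
  suc n * 1            ∎
  where
  open ≡-Reasoning
  lemma : ∀ x → 1 * x + 0 ≡ x * 1
  lemma = solve-∀
absorption (suc n) (suc k) = begin
  suc (suc k) * (suc n C suc (suc k)) + suc k * (suc n C suc k)
    ≡⟨ cong₂ (λ u v → suc (suc k) * u + suc k * v) (pascal n (suc k)) (pascal n k) ⟩
  suc (suc k) * (b + c) + suc k * (a + b)
    ≡⟨ regroup k a b c ⟩
  (suc k * b + k * a) + (suc (suc k) * c + suc k * b) + (a + b)
    ≡⟨ cong₂ (λ u v → u + v + (a + b)) (absorption n k) (absorption n (suc k)) ⟩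
  n * a + n * b + (a + b)
    ≡⟨ collect n a b ⟩
  suc n * (a + b)
    ≡⟨ cong (suc n *_) (pascal n k) ⟨
  suc n * (suc n C suc k) ∎
  where
  open ≡-Reasoning
  a = n C k
  b = n C suc k
  c = n C suc (suc k)
  regroup : ∀ k a b c → suc (suc k) * (b + c) + suc k * (a + b)
    ≡ (suc k * b + k * a) + (suc (suc k) * c + suc k * b) + (a + b)
  regroup = solve-∀
  collect : ∀ n a b → n * a + n * b + (a + b) ≡ suc n * (a + b)
  collect = solve-∀

[1+k]*[k+l]C[1+k] : ∀ k l → suc k * ((k + l) C suc k) ≡ l * ((k + l) C k)
[1+k]*[k+l]C[1+k] k l = +-cancelʳ-≡ (k * ((k + l) C k)) _ _
  (trans (absorption (k + l) k) (lemma k l _))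
  where
  lemma : ∀ k l x → (k + l) * x ≡ l * x + k * x
  lemma = solve-∀

-- Convolutions and Vandermonde's identity

convolution-tailˡ : ∀ s t i →
  convolution s t (suc i) ≡ s 0 * t (suc i) + convolution (s ∘ suc) t i
convolution-tailˡ s t i = cong (λ xs → s 0 * t (suc i) + sum xs)
  (trans (map-applyUpTo suc _ (suc i)) (sym (map-upTo _ (suc i))))

-- Peeling off the last summand directly would involve `i ∸ j`. Using `convolution-tailˡ` twice
-- inside the induction avoids any reasoning about truncated subtraction.
convolution-tailʳ : ∀ s t i →
  convolution s t (suc i) ≡ s (suc i) * t 0 + convolution s (t ∘ suc) i
convolution-tailʳ s t zero = begin
  s 0 * t 1 + (s 1 * t 0 + 0)  ≡⟨ lemma (s 0 * t 1) (s 1 * t 0) ⟩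
  s 1 * t 0 + (s 0 * t 1 + 0)  ∎
  where
  open ≡-Reasoning
  lemma : ∀ x y → x + (y + 0) ≡ y + (x + 0)
  lemma = solve-∀
convolution-tailʳ s t (suc i) = begin
  convolution s t (suc (suc i))
    ≡⟨ convolution-tailˡ s t (suc i) ⟩
  x + convolution (s ∘ suc) t (suc i)
    ≡⟨ cong (x +_) (convolution-tailʳ (s ∘ suc) t i) ⟩
  x + (y + z)
    ≡⟨ lemma x y z ⟩
  y + (x + z)
    ≡⟨ cong (y +_) (convolution-tailˡ s (t ∘ suc) i) ⟨
  y + convolution s (t ∘ suc) (suc i) ∎
  where
  open ≡-Reasoning
  x = s 0 * t (suc (suc i))
  y = s (suc (suc i)) * t 0
  z = convolution (s ∘ suc) (t ∘ suc) i
  lemma : ∀ x y z → x + (y + z) ≡ y + (x + z)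
  lemma = solve-∀

convolution-comm : ∀ s t i → convolution s t i ≡ convolution t s i
convolution-comm s t zero    = cong (_+ 0) (*-comm (s 0) (t 0))
convolution-comm s t (suc i) = begin
  convolution s t (suc i)                        ≡⟨ convolution-tailˡ s t i ⟩
  s 0 * t (suc i) + convolution (s ∘ suc) t i    ≡⟨ cong₂ _+_ (*-comm (s 0) (t (suc i))) (convolution-comm (s ∘ suc) t i) ⟩
  t (suc i) * s 0 + convolution t (s ∘ suc) i    ≡⟨ convolution-tailʳ t s i ⟨
  convolution t s (suc i)                        ∎
  where open ≡-Reasoning

convolution-cong : ∀ {s s′} t → (∀ i → s i ≡ s′ i) → ∀ i → convolution s t i ≡ convolution s′ t i
convolution-cong         t eq zero    = cong (λ x → x * t 0 + 0) (eq 0)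
convolution-cong {s} {s′} t eq (suc i) = begin
  convolution s t (suc i)                        ≡⟨ convolution-tailˡ s t i ⟩
  s 0 * t (suc i) + convolution (s ∘ suc) t i    ≡⟨ cong₂ _+_ (cong (_* t (suc i)) (eq 0)) (convolution-cong t (eq ∘ suc) i) ⟩
  s′ 0 * t (suc i) + convolution (s′ ∘ suc) t i  ≡⟨ convolution-tailˡ s′ t i ⟨
  convolution s′ t (suc i)                       ∎
  where open ≡-Reasoning

convolution-distribʳ-+ : ∀ s s′ t i →
  convolution (λ j → s j + s′ j) t i ≡ convolution s t i + convolution s′ t i
convolution-distribʳ-+ s s′ t zero = lemma (s 0) (s′ 0) (t 0)
  where
  lemma : ∀ x y z → (x + y) * z + 0 ≡ x * z + 0 + (y * z + 0)
  lemma = solve-∀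
convolution-distribʳ-+ s s′ t (suc i) = begin
  convolution (λ j → s j + s′ j) t (suc i)
    ≡⟨ convolution-tailˡ (λ j → s j + s′ j) t i ⟩
  (s 0 + s′ 0) * t (suc i) + convolution (λ j → s (suc j) + s′ (suc j)) t i
    ≡⟨ cong ((s 0 + s′ 0) * t (suc i) +_) (convolution-distribʳ-+ (s ∘ suc) (s′ ∘ suc) t i) ⟩
  (s 0 + s′ 0) * t (suc i) + (convolution (s ∘ suc) t i + convolution (s′ ∘ suc) t i)
    ≡⟨ lemma (s 0) (s′ 0) (t (suc i)) _ _ ⟩
  (s 0 * t (suc i) + convolution (s ∘ suc) t i) + (s′ 0 * t (suc i) + convolution (s′ ∘ suc) t i)
    ≡⟨ cong₂ _+_ (convolution-tailˡ s t i) (convolution-tailˡ s′ t i) ⟨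
  convolution s t (suc i) + convolution s′ t (suc i) ∎
  where
  open ≡-Reasoning
  lemma : ∀ x y z u v → (x + y) * z + (u + v) ≡ (x * z + u) + (y * z + v)
  lemma = solve-∀

convolution-zeroˡ : ∀ t i → convolution (λ _ → 0) t i ≡ 0
convolution-zeroˡ t zero    = refl
convolution-zeroˡ t (suc i) = trans (convolution-tailˡ (λ _ → 0) t i) (convolution-zeroˡ t i)

-- Induction on m: Pascal's rule splits the first factor, and the two halves reassemble into the
-- convolutions for m at i and at i + 1.
vandermonde : ∀ m n i → convolution (m C_) (n C_) i ≡ (m + n) C i
vandermonde zero    n zero    = refl
vandermonde (suc m) n zero    = refl
vandermonde zero    n (suc i) = begin
  convolution (0 C_) (n C_) (suc i)                             ≡⟨ convolution-tailˡ (0 C_) (n C_) i ⟩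
  1 * (n C suc i) + convolution (λ j → 0 C suc j) (n C_) i     ≡⟨ cong (1 * (n C suc i) +_) (convolution-zeroˡ (n C_) i) ⟩
  1 * (n C suc i) + 0                                          ≡⟨ lemma (n C suc i) ⟩
  n C suc i                                                    ∎
  where
  open ≡-Reasoning
  lemma : ∀ x → 1 * x + 0 ≡ x
  lemma = solve-∀
vandermonde (suc m) n (suc i) = begin
  convolution (suc m C_) t (suc i)
    ≡⟨ convolution-tailˡ (suc m C_) t i ⟩
  1 * t (suc i) + convolution (λ j → suc m C suc j) t i
    ≡⟨ cong (1 * t (suc i) +_) (convolution-cong t (pascal m) i) ⟩
  1 * t (suc i) + convolution (λ j → m C j + m C suc j) t i
    ≡⟨ cong (1 * t (suc i) +_) (convolution-distribʳ-+ (m C_) (λ j → m C suc j) t i) ⟩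
  1 * t (suc i) + (convolution (m C_) t i + convolution (λ j → m C suc j) t i)
    ≡⟨ lemma (1 * t (suc i)) (convolution (m C_) t i) (convolution (λ j → m C suc j) t i) ⟩
  convolution (m C_) t i + (1 * t (suc i) + convolution (λ j → m C suc j) t i)
    ≡⟨ cong (convolution (m C_) t i +_) (convolution-tailˡ (m C_) t i) ⟨
  convolution (m C_) t i + convolution (m C_) t (suc i)
    ≡⟨ cong₂ _+_ (vandermonde m n i) (vandermonde m n (suc i)) ⟩
  (m + n) C i + (m + n) C suc i
    ≡⟨ pascal (m + n) i ⟨
  (suc m + n) C suc i ∎
  where
  open ≡-Reasoning
  t = n C_
  lemma : ∀ x y z → x + (y + z) ≡ y + (x + z)
  lemma = solve-∀

-- Values and support of the two sequences

ones-first : ∀ p m → onesThenBinomials p m 0 ≡ 1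
ones-first zero    m = refl
ones-first (suc p) m = refl

-- The bound includes i = p, where the term is C(m,0) = 1.
i≤p⇒one : ∀ {p i} m → i ≤ p → onesThenBinomials p m i ≡ 1
i≤p⇒one {p}     m z≤n       = ones-first p m
i≤p⇒one {suc p} m (s≤s i≤p) = i≤p⇒one m i≤p

binomials-after-ones : ∀ p m i → onesThenBinomials p m (p + i) ≡ m C i
binomials-after-ones zero    m i = refl
binomials-after-ones (suc p) m i = binomials-after-ones p m i

i≤p+m⇒1≤term : ∀ p {m i} → i ≤ p + m → 1 ≤ onesThenBinomials p m i
i≤p+m⇒1≤term zero            i≤m         = k≤n⇒1≤nCk i≤m
i≤p+m⇒1≤term (suc p) {_} {zero}  _           = ≤-refl
i≤p+m⇒1≤term (suc p) {_} {suc i} (s≤s i≤p+m) = i≤p+m⇒1≤term p i≤p+m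

p+m<i⇒term≡0 : ∀ p {m i} → p + m < i → onesThenBinomials p m i ≡ 0
p+m<i⇒term≡0 zero            m<i         = k>n⇒nCk≡0 m<i
p+m<i⇒term≡0 (suc p) {_} {suc i} (s≤s p+m<i) = p+m<i⇒term≡0 p p+m<i

-- Differences of consecutive terms of the convolution

convolution-within-ones : ∀ {p i} m t → i < p →
  convolution (onesThenBinomials p m) t (suc i) ≡ t (suc i) + convolution (onesThenBinomials p m) t i
convolution-within-ones {suc p} {zero} m t _ = begin
  1 * t 1 + (onesThenBinomials p m 0 * t 0 + 0)  ≡⟨ cong (λ x → 1 * t 1 + (x * t 0 + 0)) (ones-first p m) ⟩
  1 * t 1 + (1 * t 0 + 0)                        ≡⟨ cong (_+ (1 * t 0 + 0)) (*-identityˡ (t 1)) ⟩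
  t 1 + (1 * t 0 + 0)                            ∎
  where open ≡-Reasoning
convolution-within-ones {suc p} {suc i} m t (s≤s i<p) = begin
  convolution s t (suc (suc i))                    ≡⟨ convolution-tailˡ s t (suc i) ⟩
  1 * t (suc (suc i)) + convolution s′ t (suc i)   ≡⟨ cong₂ _+_ (*-identityˡ (t (suc (suc i)))) (convolution-within-ones m t i<p) ⟩
  t (suc (suc i)) + (t (suc i) + convolution s′ t i)
    ≡⟨ cong (λ x → t (suc (suc i)) + (x + convolution s′ t i)) (*-identityˡ (t (suc i))) ⟨
  t (suc (suc i)) + (1 * t (suc i) + convolution s′ t i)
    ≡⟨ cong (t (suc (suc i)) +_) (convolution-tailˡ s t i) ⟨
  t (suc (suc i)) + convolution s t (suc i)        ∎
  where
  open ≡-Reasoning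
  s = onesThenBinomials (suc p) m
  s′ = onesThenBinomials p m

-- The p ones contribute the window sum t(i+1) + ⋯ + t(i+p) to the term at p + i, and the binomials
-- contribute their own convolution with t. One step further the window gains t(p+i+1) and loses
-- t(i+1).
convolution-beyond-ones : ∀ p m t i →
  convolution (onesThenBinomials p m) t (suc (p + i)) + (t (suc i) + convolution (m C_) t i)
    ≡ t (suc (p + i)) + convolution (onesThenBinomials p m) t (p + i) + convolution (m C_) t (suc i)
convolution-beyond-ones zero m t i = lemma (convolution (m C_) t (suc i)) (t (suc i)) (convolution (m C_) t i)
  where
  lemma : ∀ x y z → x + (y + z) ≡ y + z + x
  lemma = solve-∀
convolution-beyond-ones (suc p) m t i = begin
  convolution s t (suc (suc (p + i))) + y
    ≡⟨ cong (_+ y) (convolution-tailˡ s t (suc (p + i))) ⟩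
  1 * u + convolution s′ t (suc (p + i)) + y
    ≡⟨ +-assoc (1 * u) _ y ⟩
  1 * u + (convolution s′ t (suc (p + i)) + y)
    ≡⟨ cong (1 * u +_) (convolution-beyond-ones p m t i) ⟩
  1 * u + (v + convolution s′ t (p + i) + z)
    ≡⟨ lemma u v (convolution s′ t (p + i)) z ⟩
  u + (1 * v + convolution s′ t (p + i)) + z
    ≡⟨ cong (λ x → u + x + z) (convolution-tailˡ s t (p + i)) ⟨
  u + convolution s t (suc (p + i)) + z ∎
  where
  open ≡-Reasoning
  s = onesThenBinomials (suc p) m
  s′ = onesThenBinomials p m
  u = t (suc (suc (p + i)))
  v = t (suc (p + i))
  y = t (suc i) + convolution (m C_) t i
  z = convolution (m C_) t (suc i)
  lemma : ∀ u v w z → 1 * u + (v + w + z) ≡ u + (1 * v + w) + z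
  lemma = solve-∀

-- At i = p + (q + k) the difference r (suc i) − r i is rise − fall; see
-- convolution-beyond-both.
rise : (m n p q k : ℕ) → ℕ
rise m n p q k = (m + n) C suc k + (m C (q + suc k) + n C (p + suc k))

fall : (m n k : ℕ) → ℕ
fall m n k = (m + n) C k + (m C suc k + n C suc k)

-- `convolution-beyond-ones` is used twice: `eq-p` strips the ones of `s`, and `eq-q` strips those
-- of `t` from the intermediate convolution `r₀`. Vandermonde evaluates what remains, and the values
-- of `r₀` cancel.
convolution-beyond-both : ∀ m n p q k → let r = convolution (onesThenBinomials p m) (onesThenBinomials q n) in
  r (suc (p + (q + k))) + fall m n k ≡ rise m n p q k + r (p + (q + k))
convolution-beyond-both m n p q k = +-cancelʳ-≡ (r₀ (suc (q + k)) + r₀ (q + k)) _ _ (begin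
  R′ + (c + (x + y)) + (b + a)
    ≡⟨ l1 R′ c x y b a ⟩
  (R′ + (y + a)) + (b + (x + c))
    ≡⟨ cong₂ _+_ eq-p eq-q ⟩
  (Y + R + b) + (X + a + c′)
    ≡⟨ l2 Y R b X a c′ ⟩
  c′ + (X + Y) + R + (b + a) ∎)
  where
  open ≡-Reasoning
  s = onesThenBinomials p m
  t = onesThenBinomials q n
  r = convolution s t
  r₀ = convolution (m C_) t
  R = r (p + (q + k))
  R′ = r (suc (p + (q + k)))
  a = r₀ (q + k)
  b = r₀ (suc (q + k))
  c = (m + n) C k
  c′ = (m + n) C suc k
  x = m C suc k
  y = n C suc k
  X = m C (q + suc k)
  Y = n C (p + suc k)

  1+q+[p+k] : suc (p + (q + k)) ≡ q + (p + suc k)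
  1+q+[p+k] = lemma p q k
    where
    lemma : ∀ p q k → suc (p + (q + k)) ≡ q + (p + suc k)
    lemma = solve-∀

  eq-p : R′ + (y + a) ≡ Y + R + b
  eq-p = begin
    R′ + (y + a)
      ≡⟨ cong (λ z → R′ + (z + a)) (trans (cong t (sym (+-suc q k))) (binomials-after-ones q n (suc k))) ⟨
    R′ + (t (suc (q + k)) + a)
      ≡⟨ convolution-beyond-ones p m t (q + k) ⟩
    t (suc (p + (q + k))) + R + b
      ≡⟨ cong (λ z → z + R + b) (trans (cong t 1+q+[p+k]) (binomials-after-ones q n (p + suc k))) ⟩
    Y + R + b ∎

  r₀-swap : ∀ i → convolution t (m C_) i ≡ r₀ i
  r₀-swap = convolution-comm t (m C_)

  r₀₀ : ∀ i → convolution (n C_) (m C_) i ≡ (m + n) C i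
  r₀₀ i = trans (vandermonde n m i) (cong (_C i) (+-comm n m))

  eq-q : b + (x + c) ≡ X + a + c′
  eq-q = begin
    b + (x + c)
      ≡⟨ cong₂ (λ u v → u + (x + v)) (r₀-swap (suc (q + k))) (r₀₀ k) ⟨
    convolution t (m C_) (suc (q + k)) + (x + convolution (n C_) (m C_) k)
      ≡⟨ convolution-beyond-ones q n (m C_) k ⟩
    m C suc (q + k) + convolution t (m C_) (q + k) + convolution (n C_) (m C_) (suc k)
      ≡⟨ cong₂ _+_ (cong₂ _+_ (cong (m C_) (sym (+-suc q k))) (r₀-swap (q + k))) (r₀₀ (suc k)) ⟩
    X + a + c′ ∎

  l1 : ∀ R′ c x y b a → R′ + (c + (x + y)) + (b + a) ≡ (R′ + (y + a)) + (b + (x + c))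
  l1 = solve-∀
  l2 : ∀ Y R b X a c′ → (Y + R + b) + (X + a + c′) ≡ c′ + (X + Y) + R + (b + a)
  l2 = solve-∀

-- Here the ones of `s` are exhausted but those of `t` are not. The 1 on the left is t(j+1), which
-- leaves the window. C(m,j+1) is the increment of `r₀`, for which the index still lies within the
-- ones of `t`.
convolution-between : ∀ m n p {q j} → j < q →
  let s = onesThenBinomials p m ; t = onesThenBinomials q n in
  convolution s t (suc (p + j)) + 1 ≡ t (suc (p + j)) + m C suc j + convolution s t (p + j)
convolution-between m n p {q} {j} j<q = +-cancelʳ-≡ a _ _ (begin
  R′ + 1 + a
    ≡⟨ +-assoc R′ 1 a ⟩
  R′ + (1 + a)
    ≡⟨ cong (λ z → R′ + (z + a)) (i≤p⇒one n j<q) ⟨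
  R′ + (t (suc j) + a)
    ≡⟨ convolution-beyond-ones p m t j ⟩
  T + R + r₀ (suc j)
    ≡⟨ cong (T + R +_) (trans (convolution-comm (m C_) t (suc j)) (convolution-within-ones n (m C_) j<q)) ⟩
  T + R + (m C suc j + convolution t (m C_) j)
    ≡⟨ cong (λ z → T + R + (m C suc j + z)) (convolution-comm t (m C_) j) ⟩
  T + R + (m C suc j + a)
    ≡⟨ lemma T R (m C suc j) a ⟩
  T + m C suc j + R + a ∎)
  where
  open ≡-Reasoning
  s = onesThenBinomials p m
  t = onesThenBinomials q n
  r₀ = convolution (m C_) t
  a = r₀ j
  R = convolution s t (p + j)
  R′ = convolution s t (suc (p + j))
  T = t (suc (p + j))
  lemma : ∀ T R x a → T + R + (x + a) ≡ T + x + R + a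
  lemma = solve-∀

-- How the sign of a difference passes to the next index

unimodal-from : ∀ {a} b d →
  (∀ i → i < b → a i ≤ a (suc i)) →
  (∀ i → b ≤ i → a (suc i) ≤ a i → a (suc (suc i)) ≤ a (suc i)) →
  a (suc (d + b)) ≤ a (d + b) → Unimodal a
unimodal-from {a} b zero    before after end = b , before , λ i b≤i → descend (≤⇒≤′ b≤i)
  where
  descend : ∀ {i} → b ≤′ i → a (suc i) ≤ a i
  descend (≤′-reflexive refl) = end
  descend (≤′-step b≤i)       = after _ (≤′⇒≤ b≤i) (descend b≤i)
-- Search for the peak: if `a` falls at `b`, the peak is there; if it rises, the search moves on to
-- `suc b`. The fall known at `d + b` bounds the number of moves.
unimodal-from {a} b (suc d) before after end with ≤-total (a (suc b)) (a b)
... | inj₁ falls = unimodal-from b 0 before after falls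
... | inj₂ rises = unimodal-from (suc b) d before′ (λ i b<i → after i (<⇒≤ b<i))
  (subst (λ x → a (suc x) ≤ a x) (sym (+-suc d b)) end)
  where
  before′ : ∀ i → i < suc b → a i ≤ a (suc i)
  before′ i i<1+b with m<1+n⇒m<n∨m≡n i<1+b
  ... | inj₁ i<b  = before i i<b
  ... | inj₂ refl = rises

-- For m = k + l the quotient C(m,k+1)/C(m,k) is l/(k+1), so the shifted terms shrink at least this
-- fast. In `absorption` at p + k, replacing p + k by k lowers the left side, and n ≤ k + l raises
-- the right.
shifted-ratio : ∀ {n} p k l → n ≤ k + l → suc k * (n C (p + suc k)) ≤ l * (n C (p + k))
shifted-ratio {n} p k l n≤k+l = +-cancelʳ-≤ (k * X) _ _ (begin
  suc k * (n C (p + suc k)) + k * X  ≡⟨ cong (λ z → suc k * (n C z) + k * X) (+-suc p k) ⟩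
  suc k * X′ + k * X                 ≤⟨ +-mono-≤ (*-monoˡ-≤ X′ (s≤s (m≤n+m k p))) (*-monoˡ-≤ X (m≤n+m k p)) ⟩
  suc (p + k) * X′ + (p + k) * X     ≡⟨ absorption n (p + k) ⟩
  n * X                              ≤⟨ *-monoˡ-≤ X n≤k+l ⟩
  (k + l) * X                        ≡⟨ lemma k l X ⟩
  l * X + k * X                      ∎)
  where
  open ≤-Reasoning
  X = n C (p + k)
  X′ = n C suc (p + k)
  lemma : ∀ k l x → (k + l) * x ≡ l * x + k * x
  lemma = solve-∀

[1+k]*[k+l+n]C[1+k] : ∀ k l n → suc k * ((k + l + n) C suc k) ≡ (l + n) * ((k + l + n) C k)
[1+k]*[k+l+n]C[1+k] k l n =
  subst (λ z → suc k * (z C suc k) ≡ (l + n) * (z C k)) (sym (+-assoc k l n)) ([1+k]*[k+l]C[1+k] k (l + n))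

[1+j]*[1+j+l+n]C[1+j] : ∀ j l n → suc j * ((suc j + l + n) C suc j) ≡ suc (l + n) * ((suc j + l + n) C j)
[1+j]*[1+j+l+n]C[1+j] j l n =
  subst (λ z → suc j * (z C suc j) ≡ suc (l + n) * (z C j)) (lemma j l n) ([1+k]*[k+l]C[1+k] j (suc (l + n)))
  where
  lemma : ∀ j l n → j + suc (l + n) ≡ suc j + l + n
  lemma = solve-∀

-- Taking j = k - 1 and l = m - k as parameters keeps the identities below free of truncated
-- subtraction.
module Abbreviations (j l n : ℕ) where
  k = suc j
  m = k + l
  b = (m + n) C j
  c = (m + n) C k
  c′ = (m + n) C suc k
  x = m C k
  x′ = m C suc k
  y = n C k
  y′ = n C suc k

-- By `shifted-ratio`, (k+1) d(k+1) is at most (m-k) d(k) plus a remainder in which no shifted term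
-- occurs; `main` shows that the remainder is ≤ 0.
fall-step : ∀ j l n p q → let k = suc j ; m = k + l ; b = (m + n) C j ; y = n C k in
  n ≤ m →
  k * m * y ≤ b + k * n * y →
  n * suc (l + n) + k * l < suc k * suc (l + n) →
  rise m n p q j ≤ fall m n j → rise m n p q k ≤ fall m n k
fall-step j l n p q n≤m small threshold falls =
  -- k C(n,k) is added to both sides because n - k may be negative.
  *-cancelˡ-≤ (suc k) (+-cancelʳ-≤ (k * y) _ _ (begin
    suc k * (c′ + (Z′ + X′)) + k * y
      ≡⟨ l1 (suc k) c′ Z′ X′ (k * y) ⟩
    suc k * c′ + (suc k * Z′ + suc k * X′) + k * y
      ≤⟨ +-monoˡ-≤ (k * y) (+-mono-≤ (≤-reflexive ([1+k]*[k+l+n]C[1+k] k l n)) (+-mono-≤ (shifted-ratio q k l ≤-refl) (shifted-ratio p k l n≤m))) ⟩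
    (l + n) * c + (l * Z + l * X) + k * y
      ≡⟨ l2 l n c Z X (k * y) ⟩
    n * c + l * (c + (Z + X)) + k * y
      ≤⟨ +-monoˡ-≤ (k * y) (+-monoʳ-≤ (n * c) (*-monoʳ-≤ l falls)) ⟩
    n * c + l * (b + (x + y)) + k * y
      ≡⟨ l3 n c l b x y k ⟩
    (n * c + l * b + m * y) + l * x
      ≤⟨ +-monoˡ-≤ (l * x) main ⟩
    (suc k * c + n * y) + l * x
      ≡⟨ cong₂ (λ u v → suc k * c + u + v) (absorption n k) ([1+k]*[k+l]C[1+k] k l) ⟨
    (suc k * c + (suc k * y′ + k * y)) + suc k * x′
      ≡⟨ l4 (suc k) c y′ (k * y) x′ ⟩
    suc k * (c + (x′ + y′)) + k * y ∎))
  where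
  open Abbreviations j l n
  open ≤-Reasoning
  X = n C (p + k)
  X′ = n C (p + suc k)
  Z = m C (q + k)
  Z′ = m C (q + suc k)
  l1 : ∀ k′ c z x e → k′ * (c + (z + x)) + e ≡ k′ * c + (k′ * z + k′ * x) + e
  l1 = solve-∀
  l2 : ∀ l n c z x e → (l + n) * c + (l * z + l * x) + e ≡ n * c + l * (c + (z + x)) + e
  l2 = solve-∀
  l3 : ∀ n c l b x y k → n * c + l * (b + (x + y)) + k * y ≡ (n * c + l * b + (k + l) * y) + l * x
  l3 = solve-∀
  l4 : ∀ k′ c y e x → (k′ * c + (k′ * y + e)) + k′ * x ≡ k′ * (c + (x + y)) + e
  l4 = solve-∀
  l5 : ∀ k n c l b w y → k * (n * c + l * b + w * y) ≡ n * (k * c) + k * l * b + k * w * y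
  l5 = solve-∀
  l6 : ∀ n s b k l e → n * (s * b) + k * l * b + (b + e) ≡ suc (n * s + k * l) * b + e
  l6 = solve-∀
  l7 : ∀ k s b c → (suc k * s) * b + c ≡ suc k * (s * b) + c
  l7 = solve-∀
  l8 : ∀ k c n y → suc k * (k * c) + k * n * y ≡ k * (suc k * c + n * y)
  l8 = solve-∀
  kc : k * c ≡ suc (l + n) * b
  kc = [1+j]*[1+j+l+n]C[1+j] j l n
  -- After multiplication by k only C(m+n,k-1) and C(n,k) occur. Since `threshold` is strict, one
  -- copy of C(m+n,k-1) is left over, and by `small` it absorbs k (m-n) C(n,k).
  main : n * c + l * b + m * y ≤ suc k * c + n * y
  main = *-cancelˡ-≤ k (begin
    k * (n * c + l * b + m * y)
      ≡⟨ l5 k n c l b m y ⟩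
    n * (k * c) + k * l * b + k * m * y
      ≤⟨ +-monoʳ-≤ (n * (k * c) + k * l * b) small ⟩
    n * (k * c) + k * l * b + (b + k * n * y)
      ≡⟨ cong (λ z → n * z + k * l * b + (b + k * n * y)) kc ⟩
    n * (suc (l + n) * b) + k * l * b + (b + k * n * y)
      ≡⟨ l6 n (suc (l + n)) b k l (k * n * y) ⟩
    suc (n * suc (l + n) + k * l) * b + k * n * y
      ≤⟨ +-monoˡ-≤ (k * n * y) (*-monoˡ-≤ b threshold) ⟩
    (suc k * suc (l + n)) * b + k * n * y
      ≡⟨ l7 k (suc (l + n)) b (k * n * y) ⟩
    suc k * (suc (l + n) * b) + k * n * y
      ≡⟨ cong (λ z → suc k * z + k * n * y) kc ⟨
    suc k * (k * c) + k * n * y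
      ≡⟨ l8 k c n y ⟩
    k * (suc k * c + n * y) ∎)

-- The computation of `fall-step` reversed, for e in place of d. The term in C(n,k) now has the
-- favourable sign, by `n ≤ m`.
rise-step : ∀ j l n → let k = suc j ; m = k + l in
  n ≤ m →
  suc k * suc (l + n) ≤ n * suc (l + n) + k * l →
  (m + n) C j + (m C k + n C k) ≤ (m + n) C k →
  (m + n) C k + (m C suc k + n C suc k) ≤ (m + n) C suc k
rise-step j l n n≤m threshold rises =
  *-cancelˡ-≤ (suc k) (+-cancelʳ-≤ (k * y) _ _ (begin
    suc k * (c + (x′ + y′)) + k * y
      ≡⟨ l1 (suc k) c x′ y′ (k * y) ⟩
    suc k * c + suc k * x′ + (suc k * y′ + k * y)
      ≡⟨ cong₂ (λ u v → suc k * c + u + v) ([1+k]*[k+l]C[1+k] k l) (absorption n k) ⟩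
    suc k * c + l * x + n * y
      ≤⟨ +-mono-≤ (+-monoˡ-≤ (l * x) main) (*-monoˡ-≤ y n≤m) ⟩
    n * c + l * b + l * x + m * y
      ≡⟨ l2 n c l b x y k ⟩
    n * c + l * (b + (x + y)) + k * y
      ≤⟨ +-monoˡ-≤ (k * y) (+-monoʳ-≤ (n * c) (*-monoʳ-≤ l rises)) ⟩
    n * c + l * c + k * y
      ≡⟨ l3 n c l (k * y) ⟩
    (l + n) * c + k * y
      ≡⟨ cong (_+ k * y) ([1+k]*[k+l+n]C[1+k] k l n) ⟨
    suc k * c′ + k * y ∎))
  where
  open Abbreviations j l n
  open ≤-Reasoning
  l1 : ∀ k′ c x y e → k′ * (c + (x + y)) + e ≡ k′ * c + k′ * x + (k′ * y + e)
  l1 = solve-∀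
  l2 : ∀ n c l b x y k → n * c + l * b + l * x + (k + l) * y ≡ n * c + l * (b + (x + y)) + k * y
  l2 = solve-∀
  l3 : ∀ n c l e → n * c + l * c + e ≡ (l + n) * c + e
  l3 = solve-∀
  l4 : ∀ k c → k * (suc k * c) ≡ suc k * (k * c)
  l4 = solve-∀
  l5 : ∀ n s k l b → (n * s + k * l) * b ≡ n * (s * b) + k * (l * b)
  l5 = solve-∀
  l6 : ∀ k n c e → n * (k * c) + k * e ≡ k * (n * c + e)
  l6 = solve-∀
  kc : k * c ≡ suc (l + n) * b
  kc = [1+j]*[1+j+l+n]C[1+j] j l n
  main : suc k * c ≤ n * c + l * b
  main = *-cancelˡ-≤ k (begin
    k * (suc k * c)                        ≡⟨ l4 k c ⟩
    suc k * (k * c)                        ≡⟨ cong (suc k *_) kc ⟩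
    suc k * (suc (l + n) * b)              ≡⟨ *-assoc (suc k) (suc (l + n)) b ⟨
    suc k * suc (l + n) * b                ≤⟨ *-monoˡ-≤ b threshold ⟩
    (n * suc (l + n) + k * l) * b          ≡⟨ l5 n (suc (l + n)) k l b ⟩
    n * (suc (l + n) * b) + k * (l * b)    ≡⟨ cong (λ z → n * z + k * (l * b)) kc ⟨
    n * (k * c) + k * (l * b)              ≡⟨ l6 k n c (l * b) ⟩
    k * (n * c + l * b)                    ∎)

-- The threshold 2nk = (n-1)(m+n+1)

module _ (k l v : ℕ) where
  private
    n = suc v
    s = suc (l + n)

    -- With m = k + l, this and `threshold-rhs` together say that n s + k l - (k+1) s equals
    -- (n-1)(m+n+1) - 2nk.
    threshold-lhs : ∀ k l v → let n = suc v ; s = suc (l + n) in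
      suc k * s + v * k ≡ k * (2 * n) + (s + k * l)
    threshold-lhs = solve-∀

    threshold-rhs : ∀ k l v → let n = suc v ; s = suc (l + n) in
      v * suc (k + l + n) + (s + k * l) ≡ n * s + k * l + v * k
    threshold-rhs = solve-∀

  threshold-≤ : k * (2 * n) ≤ v * suc (k + l + n) → suc k * s ≤ n * s + k * l
  threshold-≤ k≤ = +-cancelʳ-≤ (v * k) _ _
    (subst₂ _≤_ (sym (threshold-lhs k l v)) (threshold-rhs k l v) (+-monoˡ-≤ (s + k * l) k≤))

  threshold-> : v * suc (k + l + n) < k * (2 * n) → n * s + k * l < suc k * s
  threshold-> k> = +-cancelʳ-< (v * k) _ _
    (subst₂ _<_ (threshold-rhs k l v) (sym (threshold-lhs k l v)) (+-monoˡ-< (s + k * l) k>))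

-- Since 2n ≤ m + n, any k ≤ n - 1 lies on or below the threshold.
beyond-threshold : ∀ {m v k} → suc v ≤ m → v * suc (m + suc v) < k * (2 * suc v) → v < k
beyond-threshold {m} {v} {k} n≤m k> = ≰⇒> λ k≤v → <-irrefl refl (begin-strict
  v * suc (m + n)  <⟨ k> ⟩
  k * (2 * n)      ≤⟨ *-monoˡ-≤ (2 * n) k≤v ⟩
  v * (2 * n)      ≤⟨ *-monoʳ-≤ v (+-mono-≤ n≤m (≤-reflexive (+-identityʳ n))) ⟩
  v * (m + n)      ≤⟨ *-monoʳ-≤ v (n≤1+n (m + n)) ⟩
  v * suc (m + n)  ∎)
  where
  open ≤-Reasoning
  n = suc v

-- Past the threshold k ≥ n, so C(n,k) vanishes unless k = n; in that case the
-- threshold inequality bounds m.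
fall-small : ∀ {m v j} → suc v ≤ m → 1 ≤ j → let n = suc v ; k = suc j in
  v * suc (m + n) < k * (2 * n) → k * m * (n C k) ≤ (m + n) C j + k * n * (n C k)
fall-small {m} {v} {j} n≤m 1≤j k> with <-≤-connex (suc v) (suc j)
... | inj₁ n<k = begin
  suc j * m * (suc v C suc j)  ≡⟨ cong (suc j * m *_) (k>n⇒nCk≡0 n<k) ⟩
  suc j * m * 0                ≡⟨ *-zeroʳ (suc j * m) ⟩
  0                            ≤⟨ z≤n ⟩
  _                            ∎
  where open ≤-Reasoning
... | inj₂ (s≤s j≤v) with ≤-antisym j≤v (s≤s⁻¹ (beyond-threshold n≤m k>))
... | refl = begin
  n * m * (n C n)                        ≡⟨ cong (n * m *_) (nCn≡1 n) ⟩
  n * m * 1                              ≤⟨ *-monoˡ-≤ 1 n*m≤ ⟩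
  (m + n + n * n) * 1                    ≡⟨ lemma (m + n) (n * n) ⟩
  m + n + n * n * 1                      ≤⟨ +-monoˡ-≤ (n * n * 1) (n≤nCk 1≤j (m≤n⇒m≤o+n m ≤-refl)) ⟩
  (m + n) C v + n * n * 1                ≡⟨ cong (λ z → (m + n) C v + n * n * z) (nCn≡1 n) ⟨
  (m + n) C v + n * n * (n C n)          ∎
  where
  open ≤-Reasoning
  n = suc v
  lemma : ∀ a b → (a + b) * 1 ≡ a + b * 1
  lemma = solve-∀
  l1 : ∀ m v → suc v * m + (m + v * v + 3 * v + 2) ≡ suc (v * suc (m + suc v)) + (2 * m + v + 1)
  l1 = solve-∀
  l2 : ∀ m v → suc v * (2 * suc v) + (2 * m + v + 1) ≡ (m + suc v + suc v * suc v) + (m + v * v + 2 * v + 1)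
  l2 = solve-∀
  -- At k = n the threshold inequality reads (n-1)(m+n+1) < 2n², whence (n-1) m ≤ n². The summands
  -- added on both sides replace subtractions. The extra m + n in the bound is paid for by
  -- C(m+n,n-1) ≥ m + n.
  n*m≤ : n * m ≤ m + n + n * n
  n*m≤ = +-cancelʳ-≤ (m + v * v + 3 * v + 2) _ _ (begin
    n * m + (m + v * v + 3 * v + 2) ≡⟨ l1 m v ⟩
    suc (v * suc (m + n)) + (2 * m + v + 1) ≤⟨ +-monoˡ-≤ _ k> ⟩
    n * (2 * n) + (2 * m + v + 1) ≡⟨ l2 m v ⟩
    (m + n + n * n) + (m + v * v + 2 * v + 1)  ≤⟨ +-monoʳ-≤ (m + n + n * n) (+-mono-≤ (+-monoʳ-≤ (m + v * v) (m≤n+m (2 * v) v)) (n≤1+n 1)) ⟩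
    (m + n + n * n) + (m + v * v + 3 * v + 2) ∎)

rise-beyond : ∀ m n p q k → m < suc k → n < suc k → rise m n p q k ≡ (m + n) C suc k
rise-beyond m n p q k m<1+k n<1+k = begin
  (m + n) C suc k + (m C (q + suc k) + n C (p + suc k))
    ≡⟨ cong₂ (λ x y → (m + n) C suc k + (x + y)) (k>n⇒nCk≡0 (m≤n⇒m≤o+n q m<1+k)) (k>n⇒nCk≡0 (m≤n⇒m≤o+n p n<1+k)) ⟩
  (m + n) C suc k + 0
    ≡⟨ +-identityʳ _ ⟩
  (m + n) C suc k ∎
  where open ≡-Reasoning

nC[1+k]≤nCk : ∀ {n k} → n ≤ k + k → n C suc k ≤ n C k
nC[1+k]≤nCk {n} {k} n≤2k = *-cancelˡ-≤ (suc k) (+-cancelʳ-≤ (k * (n C k)) _ _ (begin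
  suc k * (n C suc k) + k * (n C k)  ≡⟨ absorption n k ⟩
  n * (n C k)                        ≤⟨ *-monoˡ-≤ (n C k) n≤2k ⟩
  (k + k) * (n C k)                  ≡⟨ *-distribʳ-+ (n C k) k k ⟩
  k * (n C k) + k * (n C k)          ≤⟨ +-monoˡ-≤ (k * (n C k)) (*-monoˡ-≤ (n C k) (n≤1+n k)) ⟩
  suc k * (n C k) + k * (n C k)      ∎))
  where open ≤-Reasoning

-- For k ≤ m this is `fall-step` with l = m - k. For k > m only C(m+n,k+1) is left of the rise, and
-- m + n ≤ 2k puts it on the falling side of its row.
fall-persists : ∀ {m v} p q {j} → let n = suc v ; k = suc j in
  n ≤ m → 1 ≤ j → v * suc (m + n) < k * (2 * n) →
  rise m n p q j ≤ fall m n j → rise m n p q k ≤ fall m n k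
fall-persists {m} {v} p q {j} n≤m 1≤j k> falls with ≤-<-connex (suc j) m
... | inj₁ k≤m with m≤n⇒∃[o]m+o≡n k≤m
...   | l , refl = fall-step j l (suc v) p q n≤m (fall-small n≤m 1≤j k>) (threshold-> (suc j) l v k>) falls
fall-persists {m} {v} p q {j} n≤m 1≤j k> falls | inj₂ m<k = begin
  rise m n p q k       ≡⟨ rise-beyond m n p q k (m<n⇒m<1+n m<k) (≤-<-trans n≤m (m<n⇒m<1+n m<k)) ⟩
  (m + n) C suc k      ≤⟨ nC[1+k]≤nCk (+-mono-≤ (<⇒≤ m<k) (≤-trans n≤m (<⇒≤ m<k))) ⟩
  (m + n) C k          ≤⟨ m≤m+n _ _ ⟩
  fall m n k       ∎
  where
  open ≤-Reasoning
  n = suc v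
  k = suc j

-- The first two differences, and rises up to the threshold

[m+n]C2 : ∀ m n → (m + n) C 2 ≡ m C 2 + n C 2 + m * n
[m+n]C2 zero    n = sym (+-identityʳ (n C 2))
[m+n]C2 (suc m) n = begin
  suc (m + n) C 2                               ≡⟨ pascal (m + n) 1 ⟩
  (m + n) C 1 + (m + n) C 2                     ≡⟨ cong₂ _+_ (nC1≡n (m + n)) ([m+n]C2 m n) ⟩
  m + n + (m C 2 + n C 2 + m * n)               ≡⟨ lemma m n (m C 2) (n C 2) ⟩
  m + m C 2 + n C 2 + suc m * n                 ≡⟨ cong (λ z → z + m C 2 + n C 2 + suc m * n) (nC1≡n m) ⟨
  m C 1 + m C 2 + n C 2 + suc m * n             ≡⟨ cong (λ z → z + n C 2 + suc m * n) (pascal m 1) ⟨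
  suc m C 2 + n C 2 + suc m * n                 ∎
  where
  open ≡-Reasoning
  lemma : ∀ m n a b → m + n + (a + b + m * n) ≡ m + a + b + suc m * n
  lemma = solve-∀

fall-at-1 : ∀ m n → fall m n 1 ≡ (m C 2 + n C 2) + (m + n)
fall-at-1 m n = trans (cong (_+ (m C 2 + n C 2)) (nC1≡n (m + n))) (+-comm (m + n) _)

rise-at-1 : ∀ m n p q → rise m n p q 1 ≡ (m C 2 + n C 2) + m * n + (m C (q + 2) + n C (p + 2))
rise-at-1 m n p q = cong (_+ (m C (q + 2) + n C (p + 2))) ([m+n]C2 m n)

fall-at-0 : ∀ m n → fall m n 0 ≡ suc (m + n)
fall-at-0 m n = cong suc (cong₂ _+_ (nC1≡n m) (nC1≡n n))

rise-at-0 : ∀ m n p q → rise m n p q 0 ≡ m C (q + 1) + n C (p + 1) + (m + n)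
rise-at-0 m n p q = trans (cong (_+ (m C (q + 1) + n C (p + 1))) (nC1≡n (m + n))) (+-comm (m + n) _)

-- The slack is (m-1)(n-1) - 1, which is ab + a + b for a = m - 2 and b = n - 2.
m+n≤m*n : ∀ {m n} → 2 ≤ m → 2 ≤ n → m + n ≤ m * n
m+n≤m*n {suc (suc a)} {suc (suc b)} _ _ = ≤-trans (m≤m+n _ (a * b + a + b)) (≤-reflexive (lemma a b))
  where
  lemma : ∀ a b → suc (suc a) + suc (suc b) + (a * b + a + b) ≡ suc (suc a) * suc (suc b)
  lemma = solve-∀
m+n≤m*n {suc zero} (s≤s ()) _
m+n≤m*n {suc (suc _)} {suc zero} _ (s≤s ())

m+n<m*n : ∀ {m n} → 3 ≤ m → 2 ≤ n → m + n < m * n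
m+n<m*n {suc m} {n} (s≤s 2≤m) 2≤n = begin-strict
  1 + (m + n)  <⟨ +-mono-<-≤ 2≤n (m+n≤m*n 2≤m 2≤n) ⟩
  n + m * n    ∎
  where open ≤-Reasoning

-- The bound is placed at k + 1, the index of the difference in the conclusion. Cancelling 2n in it
-- gives k ≤ m, and weakened to k it becomes the threshold of `rise-step`.
rise-persists : ∀ {m v j} → let n = suc v ; k = suc j in
  n ≤ m → suc k * (2 * n) ≤ v * suc (m + n) →
  (m + n) C j + (m C k + n C k) ≤ (m + n) C k →
  (m + n) C k + (m C suc k + n C suc k) ≤ (m + n) C suc k
rise-persists {m} {v} {j} n≤m 1+k≤ rises = helper (m≤n⇒∃[o]m+o≡n k≤m)
  where
  open ≤-Reasoning
  n = suc v
  k = suc j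
  lemma : ∀ n a → n * (a + a) ≡ a * (2 * n)
  lemma = solve-∀
  k≤m : k ≤ m
  k≤m = s≤s⁻¹ (*-cancelʳ-≤ _ _ (2 * n) (begin
    suc k * (2 * n)        ≤⟨ 1+k≤ ⟩
    v * suc (m + n)        ≤⟨ *-mono-≤ (n≤1+n v) (s≤s (+-mono-≤ {m} ≤-refl (≤-trans n≤m (n≤1+n m)))) ⟩
    n * (suc m + suc m)    ≡⟨ lemma n (suc m) ⟩
    suc m * (2 * n)        ∎))
  helper : ∃[ l ] k + l ≡ m → (m + n) C k + (m C suc k + n C suc k) ≤ (m + n) C suc k
  helper (l , refl) = rise-step j l n n≤m
    (threshold-≤ k l v (≤-trans (*-monoˡ-≤ (2 * n) (n≤1+n k)) 1+k≤)) rises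

-- Induction starting from e(2) = mn - m - n, which is nonnegative for m, n ≥ 2. It cannot start
-- earlier, since e(1) = -1.
rises-below-threshold : ∀ {m v} j → let n = suc v ; k = suc j in
  n ≤ m → 1 ≤ j → k * (2 * n) ≤ v * suc (m + n) →
  (m + n) C j + (m C k + n C k) ≤ (m + n) C k
-- For n = 1 the right side of the bound is 0, so no k ≥ 1 satisfies it.
rises-below-threshold {m} {zero}  (suc j)       n≤m _ ()
rises-below-threshold {m} {suc w} (suc zero)    n≤m _ _ = begin
  (m + n) C 1 + (m C 2 + n C 2)   ≡⟨ fall-at-1 m n ⟩
  (m C 2 + n C 2) + (m + n)       ≤⟨ +-monoʳ-≤ (m C 2 + n C 2) (m+n≤m*n (≤-trans 2≤n n≤m) 2≤n) ⟩
  (m C 2 + n C 2) + m * n         ≡⟨ [m+n]C2 m n ⟨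
  (m + n) C 2                     ∎
  where
  open ≤-Reasoning
  n = suc (suc w)
  2≤n : 2 ≤ n
  2≤n = s≤s (s≤s z≤n)
rises-below-threshold {m} {v@(suc _)} (suc j@(suc _)) n≤m _ k≤ = rise-persists n≤m k≤
  (rises-below-threshold j n≤m (s≤s z≤n) (≤-trans (*-monoˡ-≤ (2 * suc v) (n≤1+n (suc j))) k≤))

-- Rises and falls in the three index ranges

unit-shift-≤ : ∀ {r r′ x} → r′ + 1 ≡ x + r → 1 ≤ x → r ≤ r′
unit-shift-≤ {r} {r′} eq 1≤x = +-cancelʳ-≤ 1 _ _
  (subst (r + 1 ≤_) (trans (+-comm r _) (sym eq)) (+-monoʳ-≤ r 1≤x))

-- One constructor for each difference formula: `convolution-within-ones`, `convolution-between`,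
-- `convolution-beyond-both`. Matching puts the index into the form that the formula expects.
data Position (p q : ℕ) : ℕ → Set where
  left   : ∀ {i} → i < p → Position p q i
  middle : ∀ j → j < q → Position p q (p + j)
  right  : ∀ k → Position p q (p + (q + k))

position : ∀ p q i → Position p q i
position p q i with <-≤-connex i p
... | inj₁ i<p = left i<p
... | inj₂ p≤i with m≤n⇒∃[o]m+o≡n p≤i
...   | j , refl with <-≤-connex j q
...     | inj₁ j<q = middle j j<q
...     | inj₂ q≤j with m≤n⇒∃[o]m+o≡n q≤j
...       | k , refl = right k

module _ (m n p q : ℕ) where
  private
    s = onesThenBinomials p m
    t = onesThenBinomials q n
    r = convolution s t

  left-rises : ∀ {i} → i < p → r i ≤ r (suc i)
  left-rises {i} i<p = subst (r i ≤_) (sym (convolution-within-ones m t i<p)) (m≤n+m (r i) (t (suc i)))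

  -- The difference is t(p+j+1) + C(m,j+1) - 1, so one positive summand suffices.
  middle-rises : ∀ {j} → j < q → suc j ≤ m ⊎ suc (p + j) ≤ q + n → r (p + j) ≤ r (suc (p + j))
  middle-rises {j} j<q early = unit-shift-≤ (convolution-between m n p j<q) (1≤ early)
    where
    1≤ : suc j ≤ m ⊎ suc (p + j) ≤ q + n → 1 ≤ t (suc (p + j)) + m C suc j
    1≤ (inj₁ 1+j≤m)   = ≤-trans (k≤n⇒1≤nCk 1+j≤m) (m≤n+m _ _)
    1≤ (inj₂ 1+i≤q+n) = ≤-trans (i≤p+m⇒1≤term q 1+i≤q+n) (m≤m+n _ _)

  middle-falls : ∀ {j} → j < q → m < suc j → q + n < suc (p + j) → r (suc (p + j)) ≤ r (p + j)
  middle-falls {j} j<q m<1+j q+n<1+i = ≤-trans (m≤m+n _ 1) (≤-reflexive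
    (trans (convolution-between m n p j<q)
      (cong₂ (λ x y → x + y + r (p + j)) (p+m<i⇒term≡0 q q+n<1+i) (k>n⇒nCk≡0 m<1+j))))

  right-rises : ∀ k → fall m n k ≤ rise m n p q k → r (p + (q + k)) ≤ r (suc (p + (q + k)))
  right-rises k f≤r = +-cancelˡ-≤ (rise m n p q k) _ _ (begin
    rise m n p q k + r (p + (q + k))        ≡⟨ convolution-beyond-both m n p q k ⟨
    r (suc (p + (q + k))) + fall m n k  ≤⟨ +-monoʳ-≤ (r (suc (p + (q + k)))) f≤r ⟩
    r (suc (p + (q + k))) + rise m n p q k  ≡⟨ +-comm (r (suc (p + (q + k)))) (rise m n p q k) ⟩
    rise m n p q k + r (suc (p + (q + k)))  ∎)
    where open ≤-Reasoning

  right-falls : ∀ k → rise m n p q k ≤ fall m n k → r (suc (p + (q + k))) ≤ r (p + (q + k))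
  right-falls k r≤f = +-cancelʳ-≤ (fall m n k) _ _ (begin
    r (suc (p + (q + k))) + fall m n k  ≡⟨ convolution-beyond-both m n p q k ⟩
    rise m n p q k + r (p + (q + k))        ≤⟨ +-monoˡ-≤ _ r≤f ⟩
    fall m n k + r (p + (q + k))        ≡⟨ +-comm (fall m n k) _ ⟩
    r (p + (q + k)) + fall m n k        ∎)
    where open ≤-Reasoning

  right-falls-suc : ∀ k → rise m n p q (suc k) ≤ fall m n (suc k) →
    r (suc (suc (p + (q + k)))) ≤ r (suc (p + (q + k)))
  right-falls-suc k r≤f = subst (λ i → r (suc i) ≤ r i)
    (trans (cong (p +_) (+-suc q k)) (+-suc p (q + k))) (right-falls (suc k) r≤f)

  right-rises⁻¹ : ∀ k → r (p + (q + k)) ≤ r (suc (p + (q + k))) → fall m n k ≤ rise m n p q k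
  right-rises⁻¹ k le = +-cancelʳ-≤ (r (p + (q + k))) _ _ (begin
    fall m n k + r (p + (q + k))        ≤⟨ +-monoʳ-≤ (fall m n k) le ⟩
    fall m n k + r (suc (p + (q + k)))  ≡⟨ +-comm (fall m n k) _ ⟩
    r (suc (p + (q + k))) + fall m n k  ≡⟨ convolution-beyond-both m n p q k ⟩
    rise m n p q k + r (p + (q + k))        ∎)
    where open ≤-Reasoning

  right-falls⁻¹ : ∀ k → r (suc (p + (q + k))) ≤ r (p + (q + k)) → rise m n p q k ≤ fall m n k
  right-falls⁻¹ k le = +-cancelʳ-≤ (r (p + (q + k))) _ _ (begin
    rise m n p q k + r (p + (q + k))        ≡⟨ convolution-beyond-both m n p q k ⟨
    r (suc (p + (q + k))) + fall m n k  ≤⟨ +-monoˡ-≤ _ le ⟩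
    r (p + (q + k)) + fall m n k        ≡⟨ +-comm _ (fall m n k) ⟩
    fall m n k + r (p + (q + k))        ∎)
    where open ≤-Reasoning

-- The cases of the theorem

fall-at-0-short : ∀ {m n p q} → q < m ⊎ n > p → fall m n 0 ≤ rise m n p q 0
fall-at-0-short {m} {n} {p} {q} short = begin
  fall m n 0                            ≡⟨ fall-at-0 m n ⟩
  -- d(1) = C(m,q+1) + C(n,p+1) - 1, and either alternative of `short` makes one shifted term
  -- positive.
  1 + (m + n)                               ≤⟨ +-monoˡ-≤ (m + n) (positive short) ⟩
  m C (q + 1) + n C (p + 1) + (m + n)       ≡⟨ rise-at-0 m n p q ⟨
  rise m n p q 0                            ∎
  where
  open ≤-Reasoning
  positive : q < m ⊎ p < n → 1 ≤ m C (q + 1) + n C (p + 1)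
  positive (inj₁ q<m) = ≤-trans (k≤n⇒1≤nCk (subst (_≤ m) (+-comm 1 q) q<m)) (m≤m+n _ _)
  positive (inj₂ p<n) = ≤-trans (k≤n⇒1≤nCk (subst (_≤ n) (+-comm 1 p) p<n)) (m≤n+m _ _)

shifted≡0 : ∀ {n p} k → n ≤ p → n C (p + suc k) ≡ 0
shifted≡0 {n} {p} k n≤p = k>n⇒nCk≡0 (≤-<-trans n≤p (m<m+n p (s≤s z≤n)))

long-rise-at-0 : ∀ {m n p q} → m ≤ q → n ≤ p → rise m n p q 0 ≡ m + n
long-rise-at-0 {m} {n} {p} {q} m≤q n≤p = trans (rise-at-0 m n p q)
  (cong₂ (λ x y → x + y + (m + n)) (shifted≡0 0 m≤q) (shifted≡0 0 n≤p))

long-rise-at-1 : ∀ {m n p q} → m ≤ q → n ≤ p → rise m n p q 1 ≡ (m C 2 + n C 2) + m * n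
long-rise-at-1 {m} {n} {p} {q} m≤q n≤p = trans (rise-at-1 m n p q)
  (trans (cong₂ (λ x y → (m C 2 + n C 2) + m * n + (x + y)) (shifted≡0 1 m≤q) (shifted≡0 1 n≤p)) (+-identityʳ _))

-- The sequence rises through the ones and up to the threshold; from there on a fall, once it
-- occurs, persists.
unimodal-short : ∀ m n p q → n ≤ m → 1 ≤ n → q < m ⊎ p < n →
  Unimodal (convolution (onesThenBinomials p m) (onesThenBinomials q n))
unimodal-short m n@(suc v) p q n≤m _ short =
  unimodal-from (p + (q + κ)) (m + n) before after end
  where
  r = convolution (onesThenBinomials p m) (onesThenBinomials q n)
  N = v * suc (m + n)
  -- `κ₀` is the last k that does not exceed the threshold. The maximum with 1 counts d(1), which
  -- `fall-at-0-short` treats, among the rises and supplies the `1 ≤ j` of `fall-persists`.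
  κ₀ = N / (2 * n)
  κ = 1 ⊔ κ₀

  ≤κ₀⇒≤N : ∀ {k} → k ≤ κ₀ → k * (2 * n) ≤ N
  ≤κ₀⇒≤N k≤κ₀ = ≤-trans (*-monoˡ-≤ (2 * n) k≤κ₀) (m/n*n≤m N (2 * n))

  κ₀<⇒N< : ∀ {k} → κ₀ < k → N < k * (2 * n)
  κ₀<⇒N< {k} κ₀<k = ≰⇒> λ ≤N → <⇒≱ κ₀<k
    (subst (_≤ κ₀) (m*n/n≡m k (2 * n)) (/-monoˡ-≤ (2 * n) ≤N))

  before-right : ∀ k → k < κ → fall m n k ≤ rise m n p q k
  before-right zero      _   = fall-at-0-short {m} {n} {p} {q} short
  before-right k@(suc _) k<κ = ≤-trans (rises-below-threshold k n≤m (s≤s z≤n) (≤κ₀⇒≤N k<κ₀)) (m≤m+n _ _)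
    where
    k<κ₀ : k < κ₀
    k<κ₀ = ≰⇒> λ κ₀≤k → <⇒≱ k<κ (⊔-lub (s≤s z≤n) κ₀≤k)

  before-middle : ∀ {j} → j < q → suc j ≤ m ⊎ suc (p + j) ≤ q + n
  before-middle {j} j<q = Sum.map (λ q<m → ≤-trans j<q (<⇒≤ q<m))
    (λ p<n → ≤-trans (≤-reflexive (cong suc (+-comm p j))) (+-mono-≤ j<q (<⇒≤ p<n))) short

  before : ∀ i → i < p + (q + κ) → r i ≤ r (suc i)
  before i i< with position p q i
  ... | left i<p       = left-rises m n p q i<p
  ... | middle j j<q   = middle-rises m n p q j<q (before-middle j<q)
  ... | right k        = right-rises m n p q k (before-right k (+-cancelˡ-< q _ _ (+-cancelˡ-< p _ _ i<)))

  after : ∀ i → p + (q + κ) ≤ i → r (suc i) ≤ r i → r (suc (suc i)) ≤ r (suc i)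
  after i b≤i falls with position p q i
  ... | left i<p     = ⊥-elim (<⇒≱ i<p (≤-trans (m≤m+n p (q + κ)) b≤i))
  ... | middle j j<q = ⊥-elim (<⇒≱ j<q (≤-trans (m≤m+n q κ) (+-cancelˡ-≤ p _ _ b≤i)))
  ... | right k      = right-falls-suc m n p q k
    (fall-persists p q n≤m (≤-trans (m≤m⊔n 1 κ₀) κ≤k) (κ₀<⇒N< (s≤s (≤-trans (m≤n⊔m 1 κ₀) κ≤k)))
      (right-falls⁻¹ m n p q k falls))
    where
    κ≤k : κ ≤ k
    κ≤k = +-cancelˡ-≤ q _ _ (+-cancelˡ-≤ p _ _ b≤i)

  -- A further m + n steps bring k to at least m + n, where every binomial coefficient in `rise`
  -- vanishes.
  end : r (suc (m + n + (p + (q + κ)))) ≤ r (m + n + (p + (q + κ)))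
  end = subst (λ i → r (suc i) ≤ r i) (lemma p q κ (m + n)) (right-falls m n p q K (begin
    rise m n p q K     ≡⟨ rise-beyond m n p q K (s≤s (≤-trans (m≤m+n m n) N≤K)) (s≤s (≤-trans (m≤n+m n m) N≤K)) ⟩
    (m + n) C suc K    ≡⟨ k>n⇒nCk≡0 (s≤s N≤K) ⟩
    0                  ≤⟨ z≤n ⟩
    fall m n K     ∎))
    where
    open ≤-Reasoning
    K = κ + (m + n)
    N≤K : m + n ≤ K
    N≤K = m≤n+m (m + n) κ
    lemma : ∀ p q κ d → p + (q + (κ + d)) ≡ d + (p + (q + κ))
    lemma = solve-∀

-- Every d(k) is ≤ 0: d(1) = -1, d(2) = mn - m - n ≤ 0, and `past-threshold` puts k = 2 beyond the
-- threshold, so `fall-persists` gives the rest. What remains is to locate the peak among the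
-- earlier terms.
unimodal-long : ∀ m n p q → n ≤ m → 1 ≤ n → m ≤ q → n ≤ p →
  m * n ≤ m + n → pred n * suc (m + n) < 2 * (2 * n) →
  Unimodal (convolution (onesThenBinomials p m) (onesThenBinomials q n))
unimodal-long m n@(suc v) p q n≤m _ m≤q n≤p mn≤m+n past-threshold = K , before , after
  where
  open ≤-Reasoning
  r = convolution (onesThenBinomials p m) (onesThenBinomials q n)
  -- The last index at which one of the two given sequences is nonzero. In the middle range the
  -- difference t(i+1) + C(m,i+1-p) - 1 is nonnegative before `K` and -1 from `K` on.
  K = (q + n) ⊔ (p + m)

  K≤p+q : K ≤ p + q
  K≤p+q = ⊔-lub (≤-trans (+-monoʳ-≤ q n≤p) (≤-reflexive (+-comm q p))) (+-monoʳ-≤ p m≤q)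

  falls : ∀ k → rise m n p q k ≤ fall m n k
  falls zero          = begin
    rise m n p q 0   ≡⟨ long-rise-at-0 m≤q n≤p ⟩
    m + n            ≤⟨ n≤1+n (m + n) ⟩
    suc (m + n)      ≡⟨ fall-at-0 m n ⟨
    fall m n 0   ∎
  falls (suc zero)    = begin
    rise m n p q 1               ≡⟨ long-rise-at-1 m≤q n≤p ⟩
    (m C 2 + n C 2) + m * n      ≤⟨ +-monoʳ-≤ (m C 2 + n C 2) mn≤m+n ⟩
    (m C 2 + n C 2) + (m + n)    ≡⟨ fall-at-1 m n ⟨
    fall m n 1               ∎
  falls (suc k@(suc _)) = fall-persists p q n≤m (s≤s z≤n)
    (<-≤-trans past-threshold (*-monoˡ-≤ (2 * n) {2} {suc k} (s≤s (s≤s z≤n)))) (falls k)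

  before : ∀ i → i < K → r i ≤ r (suc i)
  before i i<K with position p q i
  ... | left i<p     = left-rises m n p q i<p
  ... | right k      = ⊥-elim (<⇒≱ i<K (≤-trans K≤p+q (+-monoʳ-≤ p (m≤m+n q k))))
  ... | middle j j<q = middle-rises m n p q j<q early
    where
    early : suc j ≤ m ⊎ suc (p + j) ≤ q + n
    early with ≤-<-connex (suc j) m | ≤-<-connex (suc (p + j)) (q + n)
    ... | inj₁ 1+j≤m | _            = inj₁ 1+j≤m
    ... | inj₂ _     | inj₁ 1+i≤q+n = inj₂ 1+i≤q+n
    ... | inj₂ m<1+j | inj₂ q+n<1+i =
      ⊥-elim (<⇒≱ i<K (⊔-lub (s≤s⁻¹ q+n<1+i) (+-monoʳ-≤ p (s≤s⁻¹ m<1+j))))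

  after : ∀ i → K ≤ i → r (suc i) ≤ r i
  after i K≤i with position p q i
  ... | left i<p     = ⊥-elim (<⇒≱ i<p (≤-trans (m≤m+n p m) (≤-trans (m≤n⊔m (q + n) (p + m)) K≤i)))
  ... | right k      = right-falls m n p q k (falls k)
  ... | middle j j<q = middle-falls m n p q j<q
    (s≤s (+-cancelˡ-≤ p _ _ (≤-trans (m≤n⊔m (q + n) (p + m)) K≤i)))
    (s≤s (≤-trans (m≤m⊔n (q + n) (p + m)) K≤i))

-- The fall d(1) = -1 forces the peak to be at p + q or earlier, and then d(2) = mn - m - n > 0 is a
-- rise after the peak.
not-unimodal : ∀ {m n p q} → m ≤ q → n ≤ p → m + n < m * n →
  ¬ Unimodal (convolution (onesThenBinomials p m) (onesThenBinomials q n))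
not-unimodal {m} {n} {p} {q} m≤q n≤p m+n<mn (K , before , after)
  with <-≤-connex (p + (q + 0)) K
... | inj₁ i<K = <⇒≱ ≤-refl (begin
  suc (m + n)      ≡⟨ fall-at-0 m n ⟨
  fall m n 0   ≤⟨ right-rises⁻¹ m n p q 0 (before _ i<K) ⟩
  rise m n p q 0   ≡⟨ long-rise-at-0 m≤q n≤p ⟩
  m + n            ∎)
  where open ≤-Reasoning
... | inj₂ K≤i = <⇒≱ m+n<mn (+-cancelˡ-≤ (m C 2 + n C 2) _ _ (begin
  (m C 2 + n C 2) + m * n      ≡⟨ long-rise-at-1 m≤q n≤p ⟨
  rise m n p q 1               ≤⟨ right-falls⁻¹ m n p q 1 (after _ (≤-trans K≤i (+-monoʳ-≤ p (+-monoʳ-≤ q z≤n)))) ⟩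
  fall m n 1               ≡⟨ fall-at-1 m n ⟩
  (m C 2 + n C 2) + (m + n)    ∎))
  where open ≤-Reasoning

theorem1p2 : ∀ (m n p q : ℕ) → m ≥ n → n > 0 →
    Unimodal (convolution (onesThenBinomials p m) (onesThenBinomials q n))
    ⇔ (m > q ⊎ n > p ⊎ (m ≡ 2 × n ≡ 2) ⊎ n ≡ 1)
theorem1p2 m n p q n≤m 0<n = mk⇔ only-if if
  where
  only-if : Unimodal (convolution (onesThenBinomials p m) (onesThenBinomials q n)) →
    m > q ⊎ n > p ⊎ (m ≡ 2 × n ≡ 2) ⊎ n ≡ 1
  only-if unimodal with ≤-<-connex m q | ≤-<-connex n p | m≤n⇒m<n∨m≡n 0<n
  ... | inj₂ q<m | _        | _        = inj₁ q<m
  ... | inj₁ _   | inj₂ p<n | _        = inj₂ (inj₁ p<n)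
  ... | inj₁ _   | inj₁ _   | inj₂ 1≡n = inj₂ (inj₂ (inj₂ (sym 1≡n)))
  ... | inj₁ m≤q | inj₁ n≤p | inj₁ 2≤n with m≤n⇒m<n∨m≡n (≤-trans 2≤n n≤m)
  -- m ≥ 3 and n ≥ 2 give (m-1)(n-1) > 1; the other possibility, m = 2, forces n = 2.
  ...   | inj₁ 3≤m  = ⊥-elim (not-unimodal m≤q n≤p (m+n<m*n 3≤m 2≤n) unimodal)
  ...   | inj₂ refl = inj₂ (inj₂ (inj₁ (refl , ≤-antisym n≤m 2≤n)))

  if : m > q ⊎ n > p ⊎ (m ≡ 2 × n ≡ 2) ⊎ n ≡ 1 →
    Unimodal (convolution (onesThenBinomials p m) (onesThenBinomials q n))
  if conditions with ≤-<-connex m q | ≤-<-connex n p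
  if _ | inj₂ q<m | _        = unimodal-short m n p q n≤m 0<n (inj₁ q<m)
  if _ | inj₁ _   | inj₂ p<n = unimodal-short m n p q n≤m 0<n (inj₂ p<n)
  if (inj₁ q<m)        | inj₁ m≤q | inj₁ _   = ⊥-elim (<⇒≱ q<m m≤q)
  if (inj₂ (inj₁ p<n)) | inj₁ _   | inj₁ n≤p = ⊥-elim (<⇒≱ p<n n≤p)
  if (inj₂ (inj₂ (inj₁ (refl , refl)))) | inj₁ m≤q | inj₁ n≤p =
    -- Here mn = m + n = 4, and the threshold inequality at k = 2 is 5 < 8.
    unimodal-long 2 2 p q n≤m 0<n m≤q n≤p ≤-refl (m≤m+n 6 2)
  if (inj₂ (inj₂ (inj₂ refl))) | inj₁ m≤q | inj₁ n≤p =
    -- Here mn = m ≤ m + 1, and the threshold inequality at k = 2 is 0 < 4.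
    unimodal-long m 1 p q n≤m 0<n m≤q n≤p (≤-trans (≤-reflexive (*-identityʳ m)) (m≤m+n m 1)) (s≤s z≤n)
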